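{- Let $\{\varphi\}p\{\psi\}$ be a Hoare triple. Then $\mathrm{vc}(\{\varphi\}p\{\psi\})$, written as $\exists I_1 \cdots \exists I_n\, \pi$, is a linear Horn formula equation. Assume $\mathbb{Z} \models \mathrm{vc}(\{\varphi\}p\{\psi\})$, and let $\mu_j = [\mathrm{lfp}_{I_j}\, \Phi_{\pi}]$ and $\nu_j = \neg [\mathrm{lfp}_{K_j}\, \Phi_{\pi^D}]$ for $j = 1, \ldots, n$, where $\pi^D$ is the dual formula of $\pi$ with predicate variables named $K_1,\ldots,K_n$. Then: 1. $\mathbb{Z} \models \widetilde{\mathrm{vc}}(\{\varphi\}p\{\psi\})[I_1\backslash\mu_1,\ldots,I_n\backslash\mu_n]$ and $\mathbb{Z} \models \widetilde{\mathrm{vc}}(\{\varphi\}p\{\psi\})[I_1\backslash\nu_1,\ldots,I_n\backslash\nu_n]$. 2. If $\mathbb{Z},[I_1:=R_1,\ldots,I_n:=R_n] \models \widetilde{\mathrm{vc}}(\{\varphi\}p\{\psi\})$ for relations $R_1, \ldots ,R_n$, then $\mathbb{Z} \models \bigwedge_{j=1}^n ( ( \mu_j \to R_j) \land (R_j \to \nu_j))$.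
   Context: Language and programs: $\mathcal{L}=\{0,1,+,-,\cdot,\leq\}$ is the first-order language of arithmetic (with equality) and $\mathbb{Z}$ its standard model on the integers. $\mathbb{Z}\models\theta$ for a formula $\theta$ with free individual variables means that its universal closure holds; implications between predicates/relations mean universally quantified implication. Let $x_1,\ldots,x_k$ be the program variables. Programs are given by $$p ::= \textbf{skip} \mid x_j := t \mid p_0;p_1 \mid \textbf{if } B \textbf{ then } p_0 \textbf{ else } p_1 \mid \textbf{while } B \textbf{ do } p_0,$$ with $t$ an $\mathcal{L}$-term and $B$ a quantifier-free $\mathcal{L}$-formula, both over the program variables. A Hoare triple $\{\varphi\}p\{\psi\}$ consists of a program $p$ and first-order $\mathcal{L}$-formulas $\varphi,\psi$ whose free variables are program variables. Verification condition: $\mathrm{vc}(\{\varphi\}p\{\psi\})=\exists\overline{I}\,\forall^*\,\widetilde{\mathrm{vc}}(\{\varphi\}p\{\psi\})$, where $\forall^*$ is universal closure over individual variables (so $\pi=\forall^*\,\widetilde{\mathrm{vc}}(\{\varphi\}p\{\psi\})$), $\overline{I}=I_1,\ldots,I_n$ are all predicate variables occurring, existential quantifiers over predicate variables range over all relations on $\mathbb{Z}$, and $\widetilde{\mathrm{vc}}$ is defined by recursion on $p$: (1) $\widetilde{\mathrm{vc}}(\{\varphi\}\textbf{skip}\{\psi\})=\varphi\to\psi$; (2) $\widetilde{\mathrm{vc}}(\{\varphi\}x_j:=t\{\psi\})=\varphi\to\psi[x_j\backslash t]$; (3) $\widetilde{\mathrm{vc}}(\{\varphi\}p_0;p_1\{\psi\})=\widetilde{\mathrm{vc}}(\{\varphi\}p_0\{I\})\land\widetilde{\mathrm{vc}}(\{I\}p_1\{\psi\})$;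 (4) $\widetilde{\mathrm{vc}}(\{\varphi\}\textbf{if }B\textbf{ then }p_0\textbf{ else }p_1\{\psi\})=\widetilde{\mathrm{vc}}(\{\varphi\land B\}p_0\{\psi\})\land\widetilde{\mathrm{vc}}(\{\varphi\land\neg B\}p_1\{\psi\})$; (5) $\widetilde{\mathrm{vc}}(\{\varphi\}\textbf{while }B\textbf{ do }p_0\{\psi\})=\widetilde{\mathrm{vc}}(\{I\land B\}p_0\{I\})\land(\varphi\to I)\land(I\land\neg B\to\psi)$. In (3) and (5), $I$ is a fresh $k$-ary predicate variable (distinct from all others used), and $I$ abbreviates the atom $I(x_1,\ldots,x_k)$, so $I[x_j\backslash t]$ is $I(x_1,\ldots,t,\ldots,x_k)$. The recursion applies also when $\varphi,\psi$ contain predicate variables. Clauses: a constrained Horn clause is a formula $\varphi' \land X_{i_1}(\overline{t_1}) \land \cdots \land X_{i_m}(\overline{t_m}) \to X_{i_0}(\overline{s})$ or $\varphi' \land X_{i_1}(\overline{t_1}) \land \cdots \land X_{i_m}(\overline{t_m}) \to \bot$, $m\ge 0$, with $\varphi'$ a first-order formula without predicate variables and $\overline{t_1},\ldots,\overline{t_m},\overline{s}$ tuples of terms. A dual constrained Horn clause is a formula $\varphi'\land X_{i_0}(\overline{t})\to X_{i_1}(\overline{s_1})\lor\cdots\lor X_{i_m}(\overline{s_m})$ or $\varphi'\to X_{i_1}(\overline{s_1})\lor\cdots\lor X_{i_m}(\overline{s_m})$, $m\ge0$ (empty disjunction is $\bot$). A (dual) Horn formula equation is $\exists \overline{X}\,\forall^*\bigwedge_{C\in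 S}C$ for a finite set $S$ of (dual) constrained Horn clauses; it is linear Horn if it is both Horn and dual Horn. An implication $A\to\theta$ with first-order conclusion $\theta$ is identified with the logically equivalent clause $A\land\neg\theta\to\bot$. Least fixed points: for a tuple $\Phi=(\varphi_i(X_1,\ldots,X_n,\overline{u_i}))_{i=1}^n$ of formulas in which the $X_j$ occur only positively, with $|\overline{u_i}|=k_i$ the arity of $X_i$, and a structure $\mathcal{M}$ with domain $M$, let $F_\Phi=(F_1,\ldots,F_n)$ on $\mathcal{P}(M^{k_1})\times\cdots\times\mathcal{P}(M^{k_n})$, $F_i(R_1,\ldots,R_n)=\{\overline{a}\in M^{k_i}\mid \mathcal{M}\models\varphi_i(R_1,\ldots,R_n,\overline{a})\}$. This is monotone; $[\mathrm{lfp}_{X_i}\,\Phi]$ is interpreted in $\mathcal{M}$ as the $i$-th component of the least fixed point of $F_\Phi$, and $\neg[\mathrm{lfp}_{X_i}\,\Phi]$ as its complement. The tuple $\Phi_\theta$ for a Horn formula equation $\exists X_1\cdots\exists X_n\,\theta$: let $B_j$ be the set of clauses of $\theta$ of the form $\varphi'\to X_j(\overline{s})$, written $(\varphi',\overline{s})$, and $\mathrm{Ind}_j$ the set of clauses $\varphi'\land X_{i_1}(\overline{t_1})\land\cdots\land X_{i_m}(\overline{t_m})\to X_j(\overline{s})$ with $m\ge1$, written $(\varphi',\iota,\tau,\overline{s})$, $\iota=(i_1,\ldots,i_m)$, $\tau=(\overline{t_1},\ldots,\overline{t_m})$. Then $\Phi_\theta=(\varphi_j(X_1,\ldots,X_n,\overline{z_j}))_{j=1}^n$,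 where $\varphi_j$ is $$\exists \overline{y}\left(\bigvee_{(\varphi',\overline{s})\in B_j}(\varphi'\land\overline{z_j}=\overline{s})\lor\bigvee_{(\varphi',\iota,\tau,\overline{s})\in \mathrm{Ind}_j}\Big(\varphi'\land\bigwedge_{l=1}^m X_{i_l}(\overline{t_l})\land\overline{z_j}=\overline{s}\Big)\right),$$ $\overline{y}$ being the free variables of the clauses in $B_j\cup \mathrm{Ind}_j$ and $\overline{z_j}$ fresh variables, as many as the arity of $X_j$ (empty disjunctions are false). Dualisation: $\pi^D$ is $\pi$ with each predicate variable $I_j$ replaced by $\neg K_j$ ($K_j$ being a new name for the predicate variable of the dual formula), written as a conjunction of constrained Horn clauses by contraposition: $\varphi'\land I_i(\overline{t})\to I_j(\overline{s})$ becomes $\varphi'\land K_j(\overline{s})\to K_i(\overline{t})$; $\varphi'\to I_j(\overline{s})$ becomes $\varphi'\land K_j(\overline{s})\to\bot$; $\varphi'\land I_i(\overline{t})\to\bot$ becomes $\varphi'\to K_i(\overline{t})$. -}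

module Defs where

open import Data.Empty using (⊥; ⊥-elim)
open import Data.Fin using (Fin; zero; suc; _↑ˡ_; _↑ʳ_)
open import Data.Fin.Properties using (_≟_)
open import Data.Integer as ℤ using (ℤ)
import Data.Integer.Properties as ℤ
open import Data.List as List using (List; []; _∷_; foldl; foldr)
open import Data.List.Membership.Propositional using (_∈_)
open import Data.List.Relation.Unary.All as All using (All; []; _∷_)
open import Data.List.Relation.Unary.Any using (Any; here; there)
open import Data.Maybe as Maybe using (Maybe; just; nothing)
open import Data.Nat as ℕ using (ℕ; zero; suc)
open import Data.Product using (Σ-syntax; ∃-syntax; _×_; _,_; proj₁; proj₂)
open import Data.Unit using (⊤)
open import Data.Vec as Vec using (Vec; []; _∷_; lookup; tabulate; _++_)
open import Data.Vec.Properties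
  using (∷-injectiveˡ; ∷-injectiveʳ; lookup-++ˡ; lookup-++ʳ; tabulate-∘;
         tabulate∘lookup; tabulate-cong)
open import Data.Vec.Functional using (updateAt)
open import Function using (_∘_; id; const; _⇔_; mk⇔)
open import Function.Bundles using (module Equivalence)
open import Function.Related.Propositional using (≡⇒; equivalence)
open import Level using (0ℓ)
open import Relation.Binary.PropositionalEquality
  using (_≡_; refl; sym; trans; cong; cong₂)
open import Relation.Nullary using (¬_; yes; no)
open import Relation.Nullary.Decidable using (decidable-stable)
open import Relation.Nullary.Negation using (Stable; negated-stable)
open import Relation.Unary using (Pred; _⊆_; ∁)

open Equivalence using (to; from)

data Term (n : ℕ) : Set where
  var         : Fin n → Term n
  𝟘 𝟙         : Term n
  _⊕_ _⊖_ _⊗_ : Term n → Term n → Term n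

record Signature : Set where
  constructor sig
  field
    size  : ℕ
    arity : Fin size → ℕ

  PredVar : Set
  PredVar = Fin size

open Signature public

-- ⊥, ∧, ⇒ and ∀ are primitive; ¬, ∨ and ∃ are the usual classical
-- abbreviations, which makes the truth definition below classical.
-- Individual variables are de Bruijn indices.

infixr 6 _∧_
infixr 5 _∨_
infixr 4 _⇒_
infix  7 _≈_ _≤_

data Formula (S : Signature) (n : ℕ) : Set where
  ⊥′      : Formula S n
  _≈_ _≤_ : Term n → Term n → Formula S n
  pred    : (X : PredVar S) → Vec (Term n) (arity S X) → Formula S n
  _∧_ _⇒_ : Formula S n → Formula S n → Formula S n
  all     : Formula S (suc n) → Formula S n

~_ : ∀ {S n} → Formula S n → Formula S n
~ A = A ⇒ ⊥′

infix 7 ~_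

⊤′ : ∀ {S n} → Formula S n
⊤′ = ~ ⊥′

_∨_ : ∀ {S n} → Formula S n → Formula S n → Formula S n
A ∨ B = ~ (~ A ∧ ~ B)

ex : ∀ {S n} → Formula S (suc n) → Formula S n
ex A = ~ all (~ A)

⋀ : ∀ {S n} → List (Formula S n) → Formula S n
⋀ = foldr _∧_ ⊤′

⋁ : ∀ {S n} → List (Formula S n) → Formula S n
⋁ []             = ⊥′
⋁ (A ∷ [])       = A
⋁ (A ∷ As@(_ ∷ _)) = A ∨ ⋁ As

ex^ : ∀ {S n} m → Formula S (m ℕ.+ n) → Formula S n
ex^ zero    A = A
ex^ (suc m) A = ex^ m (ex A)

∅ : Signature
∅ = sig 0 λ ()

FirstOrder : ℕ → Set
FirstOrder = Formula ∅

embed : ∀ {S n} → FirstOrder n → Formula S n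
embed ⊥′       = ⊥′
embed (s ≈ t)  = s ≈ t
embed (s ≤ t)  = s ≤ t
embed (A ∧ B)  = embed A ∧ embed B
embed (A ⇒ B)  = embed A ⇒ embed B
embed (all A)  = all (embed A)

QuantifierFree : ∀ {S n} → Formula S n → Set
QuantifierFree (A ∧ B) = QuantifierFree A × QuantifierFree B
QuantifierFree (A ⇒ B) = QuantifierFree A × QuantifierFree B
QuantifierFree (all _) = ⊥
QuantifierFree _       = ⊤

Subst : ℕ → ℕ → Set
Subst m n = Fin m → Term n

subᵗ : ∀ {m n} → Subst m n → Term m → Term n
subᵗ σ (var i) = σ i
subᵗ σ 𝟘       = 𝟘
subᵗ σ 𝟙       = 𝟙
subᵗ σ (s ⊕ t) = subᵗ σ s ⊕ subᵗ σ t
subᵗ σ (s ⊖ t) = subᵗ σ s ⊖ subᵗ σ t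
subᵗ σ (s ⊗ t) = subᵗ σ s ⊗ subᵗ σ t

lift : ∀ {m n} → Subst m n → Subst (suc m) (suc n)
lift σ zero    = var zero
lift σ (suc i) = subᵗ (var ∘ suc) (σ i)

sub : ∀ {S m n} → Subst m n → Formula S m → Formula S n
sub σ ⊥′          = ⊥′
sub σ (s ≈ t)     = subᵗ σ s ≈ subᵗ σ t
sub σ (s ≤ t)     = subᵗ σ s ≤ subᵗ σ t
sub σ (pred X ts) = pred X (Vec.map (subᵗ σ) ts)
sub σ (A ∧ B)     = sub σ A ∧ sub σ B
sub σ (A ⇒ B)     = sub σ A ⇒ sub σ B
sub σ (all A)     = all (sub (lift σ) A)

infix 8 _[_≔_]

_[_≔_] : ∀ {S n} → Formula S n → Fin n → Term n → Formula S n
A [ j ≔ t ] = sub (updateAt var j (const t)) A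

-- In the classical reading every predicate is stable, so these are all the
-- relations on ℤ.
record Rel (k : ℕ) : Set₁ where
  field
    holds  : Pred (Vec ℤ k) 0ℓ
    stable : ∀ as → Stable (holds as)

open Rel public

Interp : Signature → Set₁
Interp S = (X : PredVar S) → Rel (arity S X)

⟦_⟧ᵗ : ∀ {n} → Term n → Vec ℤ n → ℤ
⟦ var i ⟧ᵗ ρ = lookup ρ i
⟦ 𝟘 ⟧ᵗ     ρ = ℤ.0ℤ
⟦ 𝟙 ⟧ᵗ     ρ = ℤ.1ℤ
⟦ s ⊕ t ⟧ᵗ ρ = ⟦ s ⟧ᵗ ρ ℤ.+ ⟦ t ⟧ᵗ ρ
⟦ s ⊖ t ⟧ᵗ ρ = ⟦ s ⟧ᵗ ρ ℤ.- ⟦ t ⟧ᵗ ρ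
⟦ s ⊗ t ⟧ᵗ ρ = ⟦ s ⟧ᵗ ρ ℤ.* ⟦ t ⟧ᵗ ρ

⟦_⟧ᵗˢ : ∀ {n k} → Vec (Term n) k → Vec ℤ n → Vec ℤ k
⟦ ts ⟧ᵗˢ ρ = Vec.map (λ t → ⟦ t ⟧ᵗ ρ) ts

⟦_⟧ : ∀ {S n} → Formula S n → Interp S → Pred (Vec ℤ n) 0ℓ
⟦ ⊥′ ⟧        R ρ = ⊥
⟦ s ≈ t ⟧     R ρ = ⟦ s ⟧ᵗ ρ ≡ ⟦ t ⟧ᵗ ρ
⟦ s ≤ t ⟧     R ρ = ⟦ s ⟧ᵗ ρ ℤ.≤ ⟦ t ⟧ᵗ ρ
⟦ pred X ts ⟧ R ρ = holds (R X) (⟦ ts ⟧ᵗˢ ρ)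
⟦ A ∧ B ⟧     R ρ = ⟦ A ⟧ R ρ × ⟦ B ⟧ R ρ
⟦ A ⇒ B ⟧     R ρ = ⟦ A ⟧ R ρ → ⟦ B ⟧ R ρ
⟦ all A ⟧     R ρ = ∀ a → ⟦ A ⟧ R (a ∷ ρ)

⟦⟧-stable : ∀ {S n} (A : Formula S n) R ρ → Stable (⟦ A ⟧ R ρ)
⟦⟧-stable ⊥′          R ρ ¬¬p = ¬¬p id
⟦⟧-stable (s ≈ t)     R ρ ¬¬p = decidable-stable (⟦ s ⟧ᵗ ρ ℤ.≟ ⟦ t ⟧ᵗ ρ) ¬¬p
⟦⟧-stable (s ≤ t)     R ρ ¬¬p = decidable-stable (⟦ s ⟧ᵗ ρ ℤ.≤? ⟦ t ⟧ᵗ ρ) ¬¬p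
⟦⟧-stable (pred X ts) R ρ ¬¬p = stable (R X) _ ¬¬p
⟦⟧-stable (A ∧ B)     R ρ ¬¬p =
  ⟦⟧-stable A R ρ (λ ¬a → ¬¬p (¬a ∘ proj₁)) ,
  ⟦⟧-stable B R ρ (λ ¬b → ¬¬p (¬b ∘ proj₂))
⟦⟧-stable (A ⇒ B)     R ρ ¬¬p a = ⟦⟧-stable B R ρ λ ¬b → ¬¬p λ f → ¬b (f a)
⟦⟧-stable (all A)     R ρ ¬¬p a = ⟦⟧-stable A R (a ∷ ρ) λ ¬b → ¬¬p λ f → ¬b (f a)

-- The universal closure of A is true in ℤ when R interprets the predicate
-- variables; equally, ℤ ⊨ A[X\P] for predicates P with interpretations R.
infix 3 _⊨_

_⊨_ : ∀ {S n} → Interp S → Formula S n → Set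
R ⊨ A = ∀ ρ → ⟦ A ⟧ R ρ

infix 4 _⊑_

_⊑_ : ∀ {S} → Interp S → Interp S → Set
R ⊑ R′ = ∀ X → holds (R X) ⊆ holds (R′ X)

∁ᵢ : ∀ {S} → Interp S → Interp S
∁ᵢ R X = record
  { holds  = ∁ (holds (R X))
  ; stable = λ as ¬¬¬r r → ¬¬¬r λ ¬r → ¬r r
  }

-- ∃X₁ … ∃Xₙ ∀* matrix
record FormulaEquation : Set where
  constructor ∃∀
  field
    {signature} : Signature
    {scope}     : ℕ
    matrix      : Formula signature scope

open FormulaEquation public

ℤ⊨_ : FormulaEquation → Set₁
ℤ⊨ E = ∃[ R ] R ⊨ matrix E

infix 3 ℤ⊨_

record Guard (k : ℕ) : Set where
  constructor guard
  field
    condition      : FirstOrder k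
    quantifierFree : QuantifierFree condition

open Guard public

infix  6 _:=_
infixr 5 _⨾_

data Program (k : ℕ) : Set where
  skip          : Program k
  _:=_          : Fin k → Term k → Program k
  _⨾_           : Program k → Program k → Program k
  if_then_else_ : Guard k → Program k → Program k → Program k
  while_repeat_ : Guard k → Program k → Program k

record HoareTriple (k : ℕ) : Set where
  constructor ⟪_⟫_⟪_⟫
  field
    pre     : FirstOrder k
    program : Program k
    post    : FirstOrder k

open HoareTriple public

-- the number n of predicate variables I₁, …, Iₙ of the verification condition
#I : ∀ {k} → Program k → ℕ
#I skip                  = 0
#I (_ := _)              = 0
#I (p₀ ⨾ p₁)             = suc (#I p₀ ℕ.+ #I p₁)
#I (if _ then p₀ else p₁) = #I p₀ ℕ.+ #I p₁
#I (while _ repeat p₀)       = suc (#I p₀)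

uniform : ℕ → ℕ → Signature
uniform N k = sig N (const k)

-- Freshness: `name` tells which predicate variable each occurrence
-- introduces, and the recursive calls receive disjoint parts of it.
vc̃-rec : ∀ {k N} (p : Program k) (name : Fin (#I p) → Fin N)
        (φ ψ : Formula (uniform N k) k) → Formula (uniform N k) k
vc̃-rec skip      name φ ψ = φ ⇒ ψ
vc̃-rec (j := t)  name φ ψ = φ ⇒ ψ [ j ≔ t ]
vc̃-rec (p₀ ⨾ p₁) name φ ψ =
  vc̃-rec p₀ (name ∘ suc ∘ (_↑ˡ #I p₁)) φ I ∧
  vc̃-rec p₁ (name ∘ suc ∘ (#I p₀ ↑ʳ_)) I ψ
  where I = pred (name zero) (tabulate var)
vc̃-rec (if B then p₀ else p₁) name φ ψ =
  vc̃-rec p₀ (name ∘ (_↑ˡ #I p₁)) (φ ∧ embed (condition B)) ψ ∧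
  vc̃-rec p₁ (name ∘ (#I p₀ ↑ʳ_)) (φ ∧ ~ embed (condition B)) ψ
vc̃-rec (while B repeat p₀) name φ ψ =
  vc̃-rec p₀ (name ∘ suc) (I ∧ embed (condition B)) I ∧
  (φ ⇒ I) ∧
  (I ∧ ~ embed (condition B) ⇒ ψ)
  where I = pred (name zero) (tabulate var)

vcSig : ∀ {k} → HoareTriple k → Signature
vcSig {k} T = uniform (#I (program T)) k

vc̃ : ∀ {k} (T : HoareTriple k) → Formula (vcSig T) k
vc̃ T = vc̃-rec (program T) id (embed (pre T)) (embed (post T))

vc : ∀ {k} → HoareTriple k → FormulaEquation
vc T = ∃∀ (vc̃ T)

Atom : Signature → ℕ → Set
Atom S n = Σ[ X ∈ PredVar S ] Vec (Term n) (arity S X)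

⌊_⌋ : ∀ {S n} → Atom S n → Formula S n
⌊ X , ts ⌋ = pred X ts

-- constraint ∧ X₁(t₁) ∧ … ∧ Xₘ(tₘ) → Y₁(s₁) ∨ … ∨ Yₗ(sₗ)
record Clause (S : Signature) (n : ℕ) : Set where
  constructor clause
  field
    constraint : FirstOrder n
    body head  : List (Atom S n)

  premise : Formula S n
  premise = foldl (λ A a → A ∧ ⌊ a ⌋) (embed constraint) body

  formula : Formula S n
  formula = premise ⇒ ⋁ (List.map ⌊_⌋ head)

open Clause public

IsHorn IsDualHorn : ∀ {S n} → Clause S n → Set
IsHorn     c = List.length (head c) ℕ.≤ 1
IsDualHorn c = List.length (body c) ℕ.≤ 1

-- Rewriting a formula as a conjunction of clauses: bookkeeping for ∧, and
-- the identification of A → θ, for first-order θ, with A ∧ ¬θ → ⊥.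
infix 3 _≅_

data _≅_ {S n} : Formula S n → Formula S n → Set where
  ≅-refl     : ∀ {A} → A ≅ A
  ≅-sym      : ∀ {A B} → A ≅ B → B ≅ A
  ≅-trans    : ∀ {A B C} → A ≅ B → B ≅ C → A ≅ C
  ∧-cong     : ∀ {A A′ B B′} → A ≅ A′ → B ≅ B′ → A ∧ B ≅ A′ ∧ B′
  ⇒-cong     : ∀ {A A′ B B′} → A ≅ A′ → B ≅ B′ → (A ⇒ B) ≅ (A′ ⇒ B′)
  ∧-assoc    : ∀ A B C → (A ∧ B) ∧ C ≅ A ∧ (B ∧ C)
  ∧-comm     : ∀ A B → A ∧ B ≅ B ∧ A
  ∧-identity : ∀ A → A ∧ ⊤′ ≅ A
  ⇒-goal     : ∀ A (θ : FirstOrder n) → (A ⇒ embed θ) ≅ (A ∧ ~ embed θ ⇒ ⊥′)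

record LinearHorn (E : FormulaEquation) : Set where
  field
    clauses  : List (Clause (signature E) (scope E))
    written  : matrix E ≅ ⋀ (List.map formula clauses)
    horn     : All IsHorn clauses
    dualHorn : All IsDualHorn clauses

open LinearHorn public

-- Replacing every X by the complement of its dual and contraposing
-- exchanges body and head.
dual : ∀ {S n} → Clause S n → Clause S n
dual c = record { constraint = constraint c ; body = head c ; head = body c }

FormulaTuple : Signature → Set
FormulaTuple S = (X : PredVar S) → Formula S (arity S X)

F : ∀ {S} → FormulaTuple S → Interp S → Interp S
F Φ R X = record { holds = ⟦ Φ X ⟧ R ; stable = ⟦⟧-stable (Φ X) R }

record LeastFixedPoint {S} (Φ : FormulaTuple S) : Set₁ where
  field
    lfp     : Interp S
    fixed-⊑ : F Φ lfp ⊑ lfp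
    fixed-⊒ : lfp ⊑ F Φ lfp
    least   : ∀ R → F Φ R ⊑ R → R ⊑ F Φ R → lfp ⊑ R

open LeastFixedPoint public

_≈̄_ : ∀ {S n k} → Vec (Term n) k → Vec (Term n) k → Formula S n
[]       ≈̄ []       = ⊤′
(s ∷ ss) ≈̄ (t ∷ ts) = s ≈ t ∧ (ss ≈̄ ts)

infix 7 _≈̄_

-- The variables y of a clause become the first n variables, followed by z.
y↑ : ∀ {n m} → Subst n (n ℕ.+ m)
y↑ {m = m} i = var (i ↑ˡ m)

z̄ : ∀ {n m} → Vec (Term (n ℕ.+ m)) m
z̄ {n} = tabulate λ i → var (n ↑ʳ i)

module _ {S : Signature} {n : ℕ} where

  -- s, if the head is the single atom Xⱼ(s); only Horn clauses are of interest
  headArgs : (j : PredVar S) → List (Atom S n) → Maybe (Vec (Term n) (arity S j))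
  headArgs j ((i , s) ∷ []) with i ≟ j
  ... | yes refl = just s
  ... | no _     = nothing
  headArgs j _ = nothing

  disjunctᵃ : ∀ {m} → Clause S n → Vec (Term n) m → Formula S (n ℕ.+ m)
  disjunctᵃ c s = sub y↑ (premise c) ∧ z̄ ≈̄ Vec.map (subᵗ y↑) s

  -- Clauses with an empty body are those of Bⱼ, the others those of Indⱼ.
  disjunct : (j : PredVar S) → Clause S n → Maybe (Formula S (n ℕ.+ arity S j))
  disjunct j c = Maybe.map (disjunctᵃ c) (headArgs j (head c))

  Φ[_] : List (Clause S n) → FormulaTuple S
  Φ[ cs ] j = ex^ n (⋁ (List.mapMaybe (disjunct j) cs))

-- Existence of the least fixed point of Φ[ cs ]: the double negation of
-- derivability from the clauses cs.
∅ᵢ : Interp ∅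
∅ᵢ ()

module _ {S : Signature} where

  embed-to : ∀ {n} (A : FirstOrder n) (R : Interp S) ρ →
             ⟦ embed A ⟧ R ρ → ⟦ A ⟧ ∅ᵢ ρ
  embed-from : ∀ {n} (A : FirstOrder n) (R : Interp S) ρ →
               ⟦ A ⟧ ∅ᵢ ρ → ⟦ embed A ⟧ R ρ
  embed-to (s ≈ t) R ρ p       = p
  embed-to (s ≤ t) R ρ p       = p
  embed-to (A ∧ B) R ρ (a , b) = embed-to A R ρ a , embed-to B R ρ b
  embed-to (A ⇒ B) R ρ f       = embed-to B R ρ ∘ f ∘ embed-from A R ρ
  embed-to (all A) R ρ f a     = embed-to A R (a ∷ ρ) (f a)
  embed-from (s ≈ t) R ρ p       = p
  embed-from (s ≤ t) R ρ p       = p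
  embed-from (A ∧ B) R ρ (a , b) = embed-from A R ρ a , embed-from B R ρ b
  embed-from (A ⇒ B) R ρ f       = embed-from B R ρ ∘ f ∘ embed-to A R ρ
  embed-from (all A) R ρ f a     = embed-from A R (a ∷ ρ) (f a)

-- σ, evaluated in ρ, is ρ′
_⊢_≗_ : ∀ {m n} → Vec ℤ n → Subst m n → Vec ℤ m → Set
ρ ⊢ σ ≗ ρ′ = ∀ i → ⟦ σ i ⟧ᵗ ρ ≡ lookup ρ′ i

⟦subᵗ⟧ : ∀ {m n} {σ : Subst m n} {ρ ρ′} → ρ ⊢ σ ≗ ρ′ →
         ∀ t → ⟦ subᵗ σ t ⟧ᵗ ρ ≡ ⟦ t ⟧ᵗ ρ′
⟦subᵗ⟧ e (var i) = e i
⟦subᵗ⟧ e 𝟘       = refl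
⟦subᵗ⟧ e 𝟙       = refl
⟦subᵗ⟧ e (s ⊕ t) = cong₂ ℤ._+_ (⟦subᵗ⟧ e s) (⟦subᵗ⟧ e t)
⟦subᵗ⟧ e (s ⊖ t) = cong₂ ℤ._-_ (⟦subᵗ⟧ e s) (⟦subᵗ⟧ e t)
⟦subᵗ⟧ e (s ⊗ t) = cong₂ ℤ._*_ (⟦subᵗ⟧ e s) (⟦subᵗ⟧ e t)

⟦subᵗˢ⟧ : ∀ {m n k} {σ : Subst m n} {ρ ρ′} → ρ ⊢ σ ≗ ρ′ →
          ∀ (ts : Vec (Term m) k) → ⟦ Vec.map (subᵗ σ) ts ⟧ᵗˢ ρ ≡ ⟦ ts ⟧ᵗˢ ρ′
⟦subᵗˢ⟧ e []       = refl
⟦subᵗˢ⟧ e (t ∷ ts) = cong₂ _∷_ (⟦subᵗ⟧ e t) (⟦subᵗˢ⟧ e ts)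

lift-≗ : ∀ {m n} {σ : Subst m n} {ρ ρ′} → ρ ⊢ σ ≗ ρ′ →
         ∀ a → (a ∷ ρ) ⊢ lift σ ≗ (a ∷ ρ′)
lift-≗ e a zero        = refl
lift-≗ {σ = σ} e a (suc i) = trans (⟦subᵗ⟧ (λ _ → refl) (σ i)) (e i)

⟦sub⟧ : ∀ {S m n} {σ : Subst m n} {ρ ρ′} → ρ ⊢ σ ≗ ρ′ →
        ∀ (A : Formula S m) R → ⟦ sub σ A ⟧ R ρ ⇔ ⟦ A ⟧ R ρ′
⟦sub⟧ e ⊥′      R = mk⇔ id id
⟦sub⟧ e (s ≈ t) R = ≡⇒ {k = equivalence} (cong₂ _≡_ (⟦subᵗ⟧ e s) (⟦subᵗ⟧ e t))
⟦sub⟧ e (s ≤ t) R = ≡⇒ {k = equivalence} (cong₂ ℤ._≤_ (⟦subᵗ⟧ e s) (⟦subᵗ⟧ e t))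
⟦sub⟧ e (pred X ts) R = ≡⇒ {k = equivalence} (cong (holds (R X)) (⟦subᵗˢ⟧ e ts))
⟦sub⟧ e (A ∧ B) R = mk⇔
  (λ (a , b) → to (⟦sub⟧ e A R) a , to (⟦sub⟧ e B R) b)
  (λ (a , b) → from (⟦sub⟧ e A R) a , from (⟦sub⟧ e B R) b)
⟦sub⟧ e (A ⇒ B) R = mk⇔
  (λ f → to (⟦sub⟧ e B R) ∘ f ∘ from (⟦sub⟧ e A R))
  (λ f → from (⟦sub⟧ e B R) ∘ f ∘ to (⟦sub⟧ e A R))
⟦sub⟧ e (all A) R = mk⇔
  (λ f a → to (⟦sub⟧ (lift-≗ e a) A R) (f a))
  (λ f a → from (⟦sub⟧ (lift-≗ e a) A R) (f a))

≈̄-to : ∀ {S n k} (ss ts : Vec (Term n) k) (R : Interp S) ρ →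
       ⟦ ss ≈̄ ts ⟧ R ρ → ⟦ ss ⟧ᵗˢ ρ ≡ ⟦ ts ⟧ᵗˢ ρ
≈̄-to []       []       R ρ _        = refl
≈̄-to (s ∷ ss) (t ∷ ts) R ρ (p , ps) = cong₂ _∷_ p (≈̄-to ss ts R ρ ps)

≈̄-from : ∀ {S n k} (ss ts : Vec (Term n) k) (R : Interp S) ρ →
         ⟦ ss ⟧ᵗˢ ρ ≡ ⟦ ts ⟧ᵗˢ ρ → ⟦ ss ≈̄ ts ⟧ R ρ
≈̄-from []       []       R ρ _ = id
≈̄-from (s ∷ ss) (t ∷ ts) R ρ p = ∷-injectiveˡ p , ≈̄-from ss ts R ρ (∷-injectiveʳ p)

ex^-to : ∀ {S n} m (A : Formula S (m ℕ.+ n)) R ρ →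
         ⟦ ex^ m A ⟧ R ρ → ¬ ¬ (∃[ ys ] ⟦ A ⟧ R (ys ++ ρ))
ex^-to zero    A R ρ p k = k ([] , p)
ex^-to (suc m) A R ρ p k = ex^-to m (ex A) R ρ p
  λ (ys , q) → q λ y r → k (y ∷ ys , r)

ex^-from : ∀ {S n} m (A : Formula S (m ℕ.+ n)) R ρ ys →
           ⟦ A ⟧ R (ys ++ ρ) → ⟦ ex^ m A ⟧ R ρ
ex^-from zero    A R ρ []       p = p
ex^-from (suc m) A R ρ (y ∷ ys) p = ex^-from m (ex A) R ρ ys λ k → k y p

⋁-to : ∀ {S n} (As : List (Formula S n)) R ρ →
       ⟦ ⋁ As ⟧ R ρ → ¬ ¬ Any (λ A → ⟦ A ⟧ R ρ) As
⋁-to (A ∷ [])          R ρ p k = k (here p)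
⋁-to (A ∷ As@(_ ∷ _)) R ρ p k = p (k ∘ here , λ q → ⋁-to As R ρ q (k ∘ there))

⋁-from : ∀ {S n} (As : List (Formula S n)) R ρ →
         Any (λ A → ⟦ A ⟧ R ρ) As → ⟦ ⋁ As ⟧ R ρ
⋁-from (A ∷ [])          R ρ (here p)  = p
⋁-from (A ∷ As@(_ ∷ _)) R ρ (here p)  (¬a , _)  = ¬a p
⋁-from (A ∷ As@(_ ∷ _)) R ρ (there p) (_ , ¬as) = ¬as (⋁-from As R ρ p)

module _ {S : Signature} {n : ℕ} where

  HoldsAll : Interp S → Vec ℤ n → List (Atom S n) → Set
  HoldsAll R ρ = All λ a → ⟦ ⌊ a ⌋ ⟧ R ρ

  conj-to : ∀ A (as : List (Atom S n)) R ρ →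
            ⟦ foldl (λ B a → B ∧ ⌊ a ⌋) A as ⟧ R ρ → ⟦ A ⟧ R ρ × HoldsAll R ρ as
  conj-to A []       R ρ p = p , []
  conj-to A (a ∷ as) R ρ p =
    let ((q , r) , rs) = conj-to (A ∧ ⌊ a ⌋) as R ρ p in q , r ∷ rs

  conj-from : ∀ A (as : List (Atom S n)) R ρ → ⟦ A ⟧ R ρ → HoldsAll R ρ as →
              ⟦ foldl (λ B a → B ∧ ⌊ a ⌋) A as ⟧ R ρ
  conj-from A []       R ρ p []       = p
  conj-from A (a ∷ as) R ρ p (q ∷ qs) = conj-from (A ∧ ⌊ a ⌋) as R ρ (p , q) qs

  headArgs-just : ∀ j (h : List (Atom S n)) {s} →
                  headArgs j h ≡ just s → h ≡ (j , s) ∷ []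
  headArgs-just j ((i , s) ∷ []) p with i ≟ j
  headArgs-just j ((i , s) ∷ []) refl | yes refl = refl

  just-headArgs : ∀ j (s : Vec (Term n) (arity S j)) → headArgs {S} {n} j ((j , s) ∷ []) ≡ just s
  just-headArgs j s with j ≟ j
  ... | yes refl = refl
  ... | no ¬p    = ⊥-elim (¬p refl)

  module _ {m} (ys : Vec ℤ n) (zs : Vec ℤ m) where

    y↑-≗ : (ys ++ zs) ⊢ y↑ ≗ ys
    y↑-≗ i = lookup-++ˡ ys zs i

    ⟦z̄⟧ : ⟦ z̄ {n} ⟧ᵗˢ (ys ++ zs) ≡ zs
    ⟦z̄⟧ = trans (sym (tabulate-∘ _ _))
            (trans (tabulate-cong (lookup-++ʳ ys zs)) (tabulate∘lookup zs))

  disjunct-to : ∀ {m} (c : Clause S n) (s : Vec (Term n) m) (R : Interp S) ys zs →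
                ⟦ disjunctᵃ c s ⟧ R (ys ++ zs) →
                ⟦ premise c ⟧ R ys × zs ≡ ⟦ s ⟧ᵗˢ ys
  disjunct-to c s R ys zs (p , q) =
    to (⟦sub⟧ (y↑-≗ ys zs) (premise c) R) p ,
    trans (sym (⟦z̄⟧ ys zs)) (trans (≈̄-to _ _ R _ q) (⟦subᵗˢ⟧ (y↑-≗ ys zs) s))

  disjunct-from : ∀ {m} (c : Clause S n) (s : Vec (Term n) m) (R : Interp S) ys zs →
                  ⟦ premise c ⟧ R ys → zs ≡ ⟦ s ⟧ᵗˢ ys →
                  ⟦ disjunctᵃ c s ⟧ R (ys ++ zs)
  disjunct-from c s R ys zs p q =
    from (⟦sub⟧ (y↑-≗ ys zs) (premise c) R) p ,
    ≈̄-from _ _ R _ (trans (⟦z̄⟧ ys zs) (trans q (sym (⟦subᵗˢ⟧ (y↑-≗ ys zs) s))))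

  Step : List (Clause S n) → Interp S → (j : PredVar S) → Vec ℤ (arity S j) → Set
  Step cs R j zs = ∃[ c ] ∃[ s ] ∃[ ys ]
    c ∈ cs × head c ≡ (j , s) ∷ [] × ⟦ premise c ⟧ R ys × zs ≡ ⟦ s ⟧ᵗˢ ys

  any-to : ∀ (cs : List (Clause S n)) (R : Interp S) j ys zs →
           Any (λ A → ⟦ A ⟧ R (ys ++ zs)) (List.mapMaybe (disjunct j) cs) →
           Step cs R j zs
  any-to (c ∷ cs) R j ys zs p with headArgs j (head c) in eq
  any-to (c ∷ cs) R j ys zs (here p) | just s =
    let q , r = disjunct-to c s R ys zs p in
    c , s , ys , here refl , headArgs-just j (head c) eq , q , r
  any-to (c ∷ cs) R j ys zs (there p) | just _ =
    let c , s , ys , c∈ , r = any-to cs R j ys zs p in c , s , ys , there c∈ , r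
  any-to (c ∷ cs) R j ys zs p | nothing =
    let c , s , ys , c∈ , r = any-to cs R j ys zs p in c , s , ys , there c∈ , r

  any-from : ∀ (cs : List (Clause S n)) (R : Interp S) j zs {c s ys} →
             c ∈ cs → head c ≡ (j , s) ∷ [] →
             ⟦ premise c ⟧ R ys → zs ≡ ⟦ s ⟧ᵗˢ ys →
             Any (λ A → ⟦ A ⟧ R (ys ++ zs)) (List.mapMaybe (disjunct j) cs)
  any-from (c ∷ cs) R j zs {s = s} {ys} (here refl) h p q
    with headArgs j (head c) | trans (cong (headArgs j) h) (just-headArgs j s)
  ... | just _ | refl = here (disjunct-from c s R ys zs p q)
  any-from (c ∷ cs) R j zs (there c∈) h p q with headArgs j (head c)
  ... | just _  = there (any-from cs R j zs c∈ h p q)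
  ... | nothing = any-from cs R j zs c∈ h p q

  F-to : ∀ (cs : List (Clause S n)) (R : Interp S) j {zs} →
         holds (F Φ[ cs ] R j) zs → ¬ ¬ Step cs R j zs
  F-to cs R j {zs} p k = ex^-to n (⋁ (List.mapMaybe (disjunct j) cs)) R zs p
    λ (ys , q) → ⋁-to (List.mapMaybe (disjunct j) cs) R (ys ++ zs) q
      (k ∘ any-to cs R j ys zs)

  F-from : ∀ (cs : List (Clause S n)) (R : Interp S) j {zs} →
           Step cs R j zs → holds (F Φ[ cs ] R j) zs
  F-from cs R j {zs} (c , s , ys , c∈ , h , p , q) =
    ex^-from n (⋁ (List.mapMaybe (disjunct j) cs)) R zs ys
      (⋁-from (List.mapMaybe (disjunct j) cs) R (ys ++ zs)
        (any-from cs R j zs c∈ h p q))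

  data Derivable (cs : List (Clause S n)) :
                 (j : PredVar S) → Vec ℤ (arity S j) → Set where
    derive : ∀ {c j s} (ys : Vec ℤ n) → c ∈ cs → head c ≡ (j , s) ∷ [] →
             ⟦ constraint c ⟧ ∅ᵢ ys →
             All (λ (X , ts) → Derivable cs X (⟦ ts ⟧ᵗˢ ys)) (body c) →
             Derivable cs j (⟦ s ⟧ᵗˢ ys)

  derivable : List (Clause S n) → Interp S
  derivable cs j = record
    { holds  = λ zs → ¬ ¬ Derivable cs j zs
    ; stable = λ zs → negated-stable
    }

  ¬¬-all : ∀ {A : Set} {P : A → Set} (xs : List A) →
           All (λ x → ¬ ¬ P x) xs → ¬ ¬ All P xs
  ¬¬-all []       []       k = k []
  ¬¬-all (x ∷ xs) (p ∷ ps) k = p λ q → ¬¬-all xs ps λ qs → k (q ∷ qs)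

  step : ∀ {cs j zs} → Step cs (derivable cs) j zs → ¬ ¬ Derivable cs j zs
  step {cs} (c , s , ys , c∈ , h , p , refl) k =
    let q , qs = conj-to (embed (constraint c)) (body c) (derivable cs) ys p in
    ¬¬-all (body c) qs λ ds → k (derive ys c∈ h (embed-to (constraint c) (derivable cs) ys q) ds)

  unstep : ∀ {cs j zs} → Derivable cs j zs → Step cs (derivable cs) j zs
  unstep {cs} (derive {c} {j} {s} ys c∈ h q ds) =
    c , s , ys , c∈ , h ,
    conj-from (embed (constraint c)) (body c) (derivable cs) ys (embed-from (constraint c) (derivable cs) ys q)
      (All.map (λ d k → k d) ds) ,
    refl

  module _ (cs : List (Clause S n)) (R : Interp S) (closed : F Φ[ cs ] R ⊑ R) where

    derivable⊆  : ∀ {j zs} → Derivable cs j zs → holds (R j) zs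
    derivable⊆* : ∀ {ys} {as : List (Atom S n)} →
                  All (λ (X , ts) → Derivable cs X (⟦ ts ⟧ᵗˢ ys)) as →
                  HoldsAll R ys as
    derivable⊆ (derive {c} {j} {s} ys c∈ h q ds) = closed j (F-from cs R j
      (c , s , ys , c∈ , h ,
       conj-from (embed (constraint c)) (body c) R ys (embed-from (constraint c) R ys q) (derivable⊆* ds) ,
       refl))
    derivable⊆* []       = []
    derivable⊆* (d ∷ ds) = derivable⊆ d ∷ derivable⊆* ds

  lfpΦ : (cs : List (Clause S n)) → LeastFixedPoint Φ[ cs ]
  lfpΦ cs = record
    { lfp     = derivable cs
    ; fixed-⊑ = λ j p k → F-to cs _ j p λ q → step q k
    ; fixed-⊒ = λ j p → ⟦⟧-stable (Φ[ cs ] j) _ _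
                  λ ¬q → p λ d → ¬q (F-from cs _ j (unstep d))
    ; least   = λ R closed _ j {zs} p → stable (R j) zs
                  λ ¬r → p λ d → ¬r (derivable⊆ cs R closed d)
    }

{-# OPTIONS --safe #-}

-- Every solution R is closed under the immediate consequences that define Φ,
-- so the least fixed point lies below R; a clause with empty head holds in the
-- least fixed point because its premise is positive and false in R.
-- Contraposition turns a solution R into the solution ∁R of the dual equation,
-- and back, so the complement of the least solution of the dual equation is
-- the greatest solution.
module Submission where

open import Defs
open import Data.Fin using (zero)
open import Data.Integer using (ℤ)
open import Data.List using (List; []; _∷_; map; foldl; length; _++_)
open import Data.List.Membership.Propositional using (_∈_)
open import Data.List.Membership.Propositional.Properties using (∈-map⁺; ∈-map⁻)
open import Data.List.Properties using (map-++)
open import Data.List.Relation.Unary.All as All using (All; []; _∷_)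
import Data.List.Relation.Unary.All.Properties as All
open import Data.List.Relation.Unary.Any using (Any; here; there)
import Data.List.Relation.Unary.Any.Properties as Any
open import Data.Nat as ℕ using (ℕ; z≤n; s≤s)
open import Data.Product using (_×_; _,_; proj₁; proj₂)
open import Data.Vec using (Vec; tabulate)
open import Function using (_∘_; id; _⇔_; mk⇔)
open import Function.Bundles using (module Equivalence)
import Function.Properties.Equivalence as ⇔
open import Relation.Binary.PropositionalEquality
  using (_≡_; refl; sym; cong; cong₂; subst)
open import Relation.Nullary using (¬_)
open import Relation.Unary using (_⊆_)

open Equivalence using (to; from)

sub-embed : ∀ {S m n} (σ : Subst m n) (A : FirstOrder m) →
            sub {S} σ (embed A) ≡ embed (sub σ A)
sub-embed σ ⊥′      = refl
sub-embed σ (s ≈ t) = refl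
sub-embed σ (s ≤ t) = refl
sub-embed σ (A ∧ B) = cong₂ _∧_ (sub-embed σ A) (sub-embed σ B)
sub-embed σ (A ⇒ B) = cong₂ _⇒_ (sub-embed σ A) (sub-embed σ B)
sub-embed σ (all A) = cong all (sub-embed (lift σ) A)

module _ {S : Signature} {n : ℕ} where

  conj : Formula S n → List (Atom S n) → Formula S n
  conj = foldl (λ A a → A ∧ ⌊ a ⌋)

  conj-cong : ∀ {A B} as → A ≅ B → conj A as ≅ conj B as
  conj-cong []       A≅B = A≅B
  conj-cong (a ∷ as) A≅B = conj-cong as (∧-cong A≅B ≅-refl)

  ∧-swapʳ : ∀ (A B C : Formula S n) → (A ∧ B) ∧ C ≅ (A ∧ C) ∧ B
  ∧-swapʳ A B C = ≅-trans (∧-assoc A B C)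
    (≅-trans (∧-cong ≅-refl (∧-comm B C)) (≅-sym (∧-assoc A C B)))

  -- `foldl` leaves the constraint innermost, so a conjunct arriving on the outside has to be moved
  -- past every atom to join it.
  conj-∧ : ∀ A B as → conj A as ∧ B ≅ conj (A ∧ B) as
  conj-∧ A B []       = ≅-refl
  conj-∧ A B (a ∷ as) =
    ≅-trans (conj-∧ (A ∧ ⌊ a ⌋) B as) (conj-cong as (∧-swapʳ A ⌊ a ⌋ B))

  ⊤′-∧ : ∀ (A : Formula S n) → ⊤′ ∧ A ≅ A
  ⊤′-∧ A = ≅-trans (∧-comm ⊤′ A) (∧-identity A)

  ⋀-++ : ∀ (As Bs : List (Formula S n)) → ⋀ (As ++ Bs) ≅ ⋀ As ∧ ⋀ Bs
  ⋀-++ []       Bs = ≅-sym (⊤′-∧ (⋀ Bs))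
  ⋀-++ (A ∷ As) Bs =
    ≅-trans (∧-cong ≅-refl (⋀-++ As Bs)) (≅-sym (∧-assoc A (⋀ As) (⋀ Bs)))

  -- The invariant of the preconditions met by `vc̃-rec`: each starts as a first-order formula or an
  -- atom `I` and gains only guards or their negations. The bound on `as` makes the clauses dual
  -- Horn.
  record Antecedent (φ : Formula S n) : Set where
    constructor antecedent
    field
      {α}    : FirstOrder n
      {as}   : List (Atom S n)
      linear : length as ℕ.≤ 1
      shape  : φ ≅ conj (embed α) as

  -- Exact shapes suffice, without `≅`: guards enter preconditions only, so a postcondition stays
  -- literally an embedded formula or a single atom.
  data Consequent : Formula S n → Set where
    firstOrder : ∀ θ → Consequent (embed θ)
    atom       : ∀ a → Consequent ⌊ a ⌋

  embed-antecedent : ∀ θ → Antecedent (embed θ)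
  embed-antecedent θ = antecedent {α = θ} {[]} z≤n ≅-refl

  atom-antecedent : ∀ a → Antecedent ⌊ a ⌋
  atom-antecedent a =
    antecedent {α = ⊤′} {a ∷ []} (s≤s z≤n) (≅-sym (⊤′-∧ ⌊ a ⌋))

  ∧-antecedent : ∀ {φ} → Antecedent φ → ∀ β → Antecedent (φ ∧ embed β)
  ∧-antecedent (antecedent {α} {as} l e) β = antecedent {α = α ∧ β} {as} l
    (≅-trans (∧-cong e ≅-refl) (conj-∧ (embed α) (embed β) as))

  ∧-linearHorn : ∀ {A B : Formula S n} →
                 LinearHorn (∃∀ A) → LinearHorn (∃∀ B) → LinearHorn (∃∀ (A ∧ B))
  ∧-linearHorn {A} {B} G H = record
    { clauses  = clauses G ++ clauses H
    ; written  = subst (λ Cs → A ∧ B ≅ ⋀ Cs) (sym (map-++ formula (clauses G) (clauses H)))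
                   (≅-trans (∧-cong (written G) (written H))
                     (≅-sym (⋀-++ (map formula (clauses G)) (map formula (clauses H)))))
    ; horn     = All.++⁺ (horn G) (horn H)
    ; dualHorn = All.++⁺ (dualHorn G) (dualHorn H)
    }

  ⇒-linearHorn : ∀ {φ ψ} → Antecedent φ → Consequent ψ → LinearHorn (∃∀ (φ ⇒ ψ))
  -- The negation of `θ` is absorbed into the constraint, which leaves the head empty.
  ⇒-linearHorn {φ} A (firstOrder θ) with ∧-antecedent A (~ θ)
  ... | antecedent {α} {as} l e = record
    { clauses  = clause α as [] ∷ []
    ; written  = ≅-trans (⇒-goal φ θ)
                   (≅-trans (⇒-cong e ≅-refl) (≅-sym (∧-identity _)))
    ; horn     = z≤n ∷ []
    ; dualHorn = l ∷ []
    }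
  ⇒-linearHorn (antecedent {α} {as} l e) (atom a) = record
    { clauses  = clause α as (a ∷ []) ∷ []
    ; written  = ≅-trans (⇒-cong e ≅-refl) (≅-sym (∧-identity _))
    ; horn     = s≤s z≤n ∷ []
    ; dualHorn = l ∷ []
    }

-- For assignments: substitution changes the arguments of an atom but leaves it one atom, and it
-- commutes with `embed`.
sub-consequent : ∀ {S m n} (σ : Subst m n) {ψ : Formula S m} →
                 Consequent ψ → Consequent (sub σ ψ)
sub-consequent σ (firstOrder θ) =
  subst Consequent (sym (sub-embed σ θ)) (firstOrder (sub σ θ))
sub-consequent σ (atom (X , ts)) = atom (X , _)

-- Induction on `p`, with `φ` and `ψ` general enough to absorb what the recursion passes down: fresh
-- atoms on either side, guards on the left.
vc̃-rec-linearHorn : ∀ {k N} (p : Program k) name {φ ψ : Formula (uniform N k) k} →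
                    Antecedent φ → Consequent ψ →
                    LinearHorn (∃∀ (vc̃-rec p name φ ψ))
vc̃-rec-linearHorn skip     name A C = ⇒-linearHorn A C
vc̃-rec-linearHorn (j := t) name A C = ⇒-linearHorn A (sub-consequent _ C)
vc̃-rec-linearHorn (p₀ ⨾ p₁) name A C = ∧-linearHorn
  (vc̃-rec-linearHorn p₀ _ A (atom I))
  (vc̃-rec-linearHorn p₁ _ (atom-antecedent I) C)
  where I = name zero , tabulate var
vc̃-rec-linearHorn (if B then p₀ else p₁) name A C = ∧-linearHorn
  (vc̃-rec-linearHorn p₀ _ (∧-antecedent A (condition B)) C)
  (vc̃-rec-linearHorn p₁ _ (∧-antecedent A (~ condition B)) C)
vc̃-rec-linearHorn (while B repeat p₀) name A C = ∧-linearHorn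
  (vc̃-rec-linearHorn p₀ _ (∧-antecedent (atom-antecedent I) (condition B)) (atom I))
  (∧-linearHorn
    (⇒-linearHorn A (atom I))
    (⇒-linearHorn (∧-antecedent (atom-antecedent I) (~ condition B)) C))
  where I = name zero , tabulate var

vc-linearHorn : ∀ {k} (T : HoareTriple k) → LinearHorn (vc T)
vc-linearHorn T =
  vc̃-rec-linearHorn (program T) id (embed-antecedent (pre T)) (firstOrder (post T))

module _ {S : Signature} {n : ℕ} where

  ≅-sound : ∀ {A B : Formula S n} → A ≅ B → ∀ R ρ → ⟦ A ⟧ R ρ ⇔ ⟦ B ⟧ R ρ
  ≅-sound ≅-refl        R ρ = ⇔.refl
  ≅-sound (≅-sym e)     R ρ = ⇔.sym (≅-sound e R ρ)
  ≅-sound (≅-trans e f) R ρ = ⇔.trans (≅-sound e R ρ) (≅-sound f R ρ)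
  ≅-sound (∧-cong e f)  R ρ = mk⇔
    (λ (a , b) → to (≅-sound e R ρ) a , to (≅-sound f R ρ) b)
    (λ (a , b) → from (≅-sound e R ρ) a , from (≅-sound f R ρ) b)
  ≅-sound (⇒-cong e f)  R ρ = mk⇔
    (λ g → to (≅-sound f R ρ) ∘ g ∘ from (≅-sound e R ρ))
    (λ g → from (≅-sound f R ρ) ∘ g ∘ to (≅-sound e R ρ))
  ≅-sound (∧-assoc A B C) R ρ = mk⇔
    (λ ((a , b) , c) → a , b , c) (λ (a , b , c) → (a , b) , c)
  ≅-sound (∧-comm A B)   R ρ = mk⇔ (λ (a , b) → b , a) (λ (b , a) → a , b)
  ≅-sound (∧-identity A) R ρ = mk⇔ proj₁ (_, id)
  ≅-sound (⇒-goal A θ)   R ρ = mk⇔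
    (λ f (a , ¬t) → ¬t (f a))
    -- The classical step from the double negation of `θ` to `θ`.
    (λ f a → ⟦⟧-stable (embed θ) R ρ λ ¬t → f (a , ¬t))

  Models : Interp S → List (Clause S n) → Set
  Models R cs = ∀ {c} → c ∈ cs → R ⊨ formula c

  ⋀⇒models : ∀ R cs → R ⊨ ⋀ (map formula cs) → Models R cs
  ⋀⇒models R (c ∷ cs) m (here refl) ρ = proj₁ (m ρ)
  ⋀⇒models R (c ∷ cs) m (there c∈)    = ⋀⇒models R cs (proj₂ ∘ m) c∈

  models⇒⋀ : ∀ R cs → Models R cs → R ⊨ ⋀ (map formula cs)
  models⇒⋀ R []       m ρ = id
  models⇒⋀ R (c ∷ cs) m ρ = m (here refl) ρ , models⇒⋀ R cs (m ∘ there) ρ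

  conj-mono : ∀ (R R′ : Interp S) → R ⊑ R′ → ∀ (A : FirstOrder n) as ρ →
              ⟦ conj (embed A) as ⟧ R ρ → ⟦ conj (embed A) as ⟧ R′ ρ
  conj-mono R R′ R⊑R′ A as ρ p =
    let q , qs = conj-to (embed A) as R ρ p in
    conj-from (embed A) as R′ ρ (embed-from A R′ ρ (embed-to A R ρ q))
      (All.map (λ {(X , _)} → R⊑R′ X) qs)

  SomeHolds : Interp S → Vec ℤ n → List (Atom S n) → Set
  SomeHolds R ρ = Any λ a → ⟦ ⌊ a ⌋ ⟧ R ρ

  -- This form treats body and head as lists of atoms, so that exchanging them becomes plain
  -- contraposition.
  formula⇔ : ∀ (c : Clause S n) R ρ → ⟦ formula c ⟧ R ρ ⇔
    (⟦ constraint c ⟧ ∅ᵢ ρ → HoldsAll R ρ (body c) → ¬ ¬ SomeHolds R ρ (head c))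
  formula⇔ c R ρ = mk⇔
    (λ f q qs ¬h → ⋁-to hs R ρ
      (f (conj-from α (body c) R ρ (embed-from (constraint c) R ρ q) qs))
      (¬h ∘ Any.map⁻))
    (λ f p → let q , qs = conj-to α (body c) R ρ p in
      ⟦⟧-stable (⋁ hs) R ρ λ ¬h →
        f (embed-to (constraint c) R ρ q) qs (¬h ∘ ⋁-from hs R ρ ∘ Any.map⁺))
    where
    α  = embed (constraint c)
    hs = map ⌊_⌋ (head c)

  dual-formula : ∀ (c : Clause S n) R ρ →
                 ⟦ formula c ⟧ R ρ → ⟦ formula (dual c) ⟧ (∁ᵢ R) ρ
  dual-formula c R ρ f = from (formula⇔ (dual c) (∁ᵢ R) ρ) λ q ¬hs ¬b →
    to (formula⇔ c R ρ) f q
      -- No body atom is false in `R`, so by stability each one is true there.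
      (All.map (λ {a} → ⟦⟧-stable ⌊ a ⌋ R ρ) (All.¬Any⇒All¬ (body c) ¬b))
      (All.All¬⇒¬Any ¬hs)

  models-dual : ∀ R {cs} → Models R cs → Models (∁ᵢ R) (map dual cs)
  models-dual R m c∈ ρ with ∈-map⁻ dual c∈
  ... | c , c∈′ , refl = dual-formula c R ρ (m c∈′ ρ)

  -- `dual` is an involution by record eta, so dualising `dual c` yields `c` itself.
  models-undual : ∀ R {cs} → Models R (map dual cs) → Models (∁ᵢ R) cs
  models-undual R m {c} c∈ ρ = dual-formula (dual c) R ρ (m (∈-map⁺ dual c∈) ρ)

  models⇒closed : ∀ R {cs} → Models R cs → F Φ[ cs ] R ⊑ R
  models⇒closed R {cs} m j p = stable (R j) _ λ ¬r → F-to cs R j p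
    λ { (c , s , ys , c∈ , h , q , refl) →
        ¬r (subst (λ as → ⟦ ⋁ (map ⌊_⌋ as) ⟧ R ys) h (m c∈ ys q)) }

  -- A model is closed under `F` but may fail to be a fixed point, so `least` does not apply to it;
  -- the bound comes from induction on derivations.
  derivable-least : ∀ R cs → Models R cs → derivable cs ⊑ R
  derivable-least R cs m j d = stable (R j) _ λ ¬r →
    d (¬r ∘ derivable⊆ cs R (models⇒closed R m))

  -- A clause with one head atom is itself the derivation step that proves its head. The model `R`
  -- serves the clauses with empty head, and `IsHorn` excludes longer heads.
  derivable-models : ∀ R cs → All IsHorn cs → Models R cs →
                     Models (derivable cs) cs
  derivable-models R cs horns m {clause α as []} c∈ ρ p =
    m c∈ ρ (conj-mono (derivable cs) R (derivable-least R cs m) α as ρ p)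
  derivable-models R cs horns m {clause α as ((j , s) ∷ [])} c∈ ρ p =
    step (_ , s , ρ , c∈ , refl , p , refl)
  derivable-models R cs horns m {clause α as (_ ∷ _ ∷ _)} c∈ ρ p
    with All.lookup horns c∈
  ... | s≤s ()

corollary15 : ∀ {k : ℕ} (T : HoareTriple k) →
    LinearHorn (vc T) ×
    ((π : LinearHorn (vc T)) → ℤ⊨ vc T →
      let μ = lfp (lfpΦ (clauses π))
          ν = ∁ᵢ (lfp (lfpΦ (map dual (clauses π))))
      in ((μ ⊨ vc̃ T) × (ν ⊨ vc̃ T)) ×
         (∀ (R : Interp (vcSig T)) → R ⊨ vc̃ T →
           ∀ j → (holds (μ j) ⊆ holds (R j)) × (holds (R j) ⊆ holds (ν j))))
corollary15 T = vc-linearHorn T , λ π (R₀ , R₀⊨) →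
  let cs  = clauses π
      cs* = map dual cs

      models : ∀ R → R ⊨ vc̃ T → Models R cs
      models R R⊨ = ⋀⇒models R cs λ ρ → to (≅-sound (written π) R ρ) (R⊨ ρ)

      satisfies : ∀ R → Models R cs → R ⊨ vc̃ T
      satisfies R m ρ = from (≅-sound (written π) R ρ) (models⇒⋀ R cs m ρ)

      models* : ∀ R → R ⊨ vc̃ T → Models (∁ᵢ R) cs*
      models* R R⊨ = models-dual R (models R R⊨)

      μ = derivable cs
      κ = derivable cs*
  in
  ( satisfies μ (derivable-models R₀ cs (horn π) (models R₀ R₀⊨))
  , satisfies (∁ᵢ κ) (models-undual κ
      -- `dual` swaps body and head, so dual Horn for `cs` is Horn for `cs*`.
      (derivable-models (∁ᵢ R₀) cs* (All.map⁺ (dualHorn π)) (models* R₀ R₀⊨)))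
  ) ,
  λ R R⊨ j →
    derivable-least R cs (models R R⊨) j ,
    -- `κ` lies below the complement of `R`; contraposed, `R` lies below the complement of `κ`.
    λ r d → derivable-least (∁ᵢ R) cs* (models* R R⊨) j d r
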